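{- Let $n,m,k\ge2$ be integers with $n\ge(m+1)k$ and such that $m+1=p$ is a prime. Then $\chi(\mathrm{KN}(n,k,m))\ge\dfrac{\frac{n}{p}-k}{p(p-1)}$.
   Context: The generalized Kneser graph $\mathrm{KN}(n,k,m)$ has vertex set consisting of all ordered $m$-tuples $(A_1,\dots,A_m)$ of pairwise disjoint $k$-element subsets of $[n]=\{1,\dots,n\}$. Two vertices $\mathcal{A}=(A_1,\dots,A_m)$ and $\mathcal{B}=(B_1,\dots,B_m)$ are adjacent if either (i) $\big(\bigcup_{\ell=1}^iA_\ell\big)\cap\big(\bigcup_{\ell=i}^mB_\ell\big)=\varnothing$ for all $i\in[m]$, or (ii) $\big(\bigcup_{\ell=1}^iB_\ell\big)\cap\big(\bigcup_{\ell=i}^mA_\ell\big)=\varnothing$ for all $i\in[m]$. -}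

module Defs where

open import Data.Nat using (ℕ; _≤_)
open import Data.Fin using (Fin)
import Data.Fin as F
open import Data.Fin.Subset using (Subset; _∈_; ∣_∣)
open import Data.Product using (Σ; _×_; ∃-syntax; proj₁)
open import Data.Sum using (_⊎_)
open import Relation.Nullary using (¬_)
open import Relation.Binary.PropositionalEquality using (_≡_; _≢_)

Tuple : ℕ → ℕ → Set
Tuple n m = Fin m → Subset n

IsKNVertex : (n k m : ℕ) → Tuple n m → Set
IsKNVertex n k m A =
  ((i : Fin m) → ∣ A i ∣ ≡ k) ×
  ((i j : Fin m) → i ≢ j → (x : Fin n) → x ∈ A i → ¬ (x ∈ A j))

KNVertex : (n k m : ℕ) → Set
KNVertex n k m = Σ (Tuple n m) (IsKNVertex n k m)

InInitUnion : {n m : ℕ} → Tuple n m → Fin m → Fin n → Set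
InInitUnion A i x = ∃[ ℓ ] (ℓ F.≤ i × x ∈ A ℓ)

InFinalUnion : {n m : ℕ} → Tuple n m → Fin m → Fin n → Set
InFinalUnion B i x = ∃[ ℓ ] (i F.≤ ℓ × x ∈ B ℓ)

Precedes : {n m : ℕ} → Tuple n m → Tuple n m → Set
Precedes {n} {m} A B =
  (i : Fin m) (x : Fin n) → ¬ (InInitUnion A i x × InFinalUnion B i x)

KNAdj : {n k m : ℕ} → KNVertex n k m → KNVertex n k m → Set
KNAdj u v = Precedes (proj₁ u) (proj₁ v) ⊎ Precedes (proj₁ v) (proj₁ u)

ProperColouring : (n k m t : ℕ) → Set
ProperColouring n k m t =
  Σ (KNVertex n k m → Fin t)
    (λ c → (u v : KNVertex n k m) → KNAdj u v → c u ≢ c v)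

{-# OPTIONS --safe #-}
module Submission where

-- In fact n ≤ (k + t) p.  Let ℤ/p act on the sign vectors X ∈ ((ℤ/p) ∪ {0})ⁿ and write X_g for
-- the set of coordinates with sign g.  Attach to X, for a < k, the set of all g with |X_g| > a,
-- and for each colour c the set of all g such that c is the colour of a tuple whose i-th set lies
-- in X_{g-i}.  These k + t subsets of ℤ/p grow with X.  No colour set contains both g and g - 1,
-- because the corresponding tuples are adjacent.  Hence removing a coordinate of X either
-- decreases the total size of the subsets (at most (k + t) p) or changes none of them; in the
-- latter case one of them is nonempty and proper.  As p is prime, a nonempty proper subset of
-- ℤ/p has an equivariant "centre" in ℤ/p, the mean of its elements, which gives X a label
-- (the first nonzero sign serves as label when none of the subsets is nonempty and proper).
-- The ℤ/p-Tucker lemma says that an equivariant labelling s of the nonzero sign vectors admits a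
-- chain X₁ ⊂ … ⊂ Xₙ with s(Xᵢ) ≠ s(Xᵢ₊₁) for all i; along it the total size strictly increases.
-- The Tucker lemma follows by evaluating, on a chain of the join (ℤ/p)^{*n}, the pullback along s
-- of the generator of Hⁿ⁻¹(ℤ/p; ℤ/p): the value is 1 mod p, whereas normalised cochains vanish on
-- words with a repeated letter.

open import Defs
open import Data.Nat as ℕ using (ℕ; zero; suc; z≤n; s≤s)
open import Data.Nat.Primality using (Prime; prime⇒nonTrivial)
open import Data.Nat.DivMod using (_%_; _/_)
open import Data.Nat.GeneralisedArithmetic using (fold)
open import Data.Nat.Coprimality using (prime⇒coprime; coprime-Bézout)
open import Data.Nat.GCD using (module Bézout)
open import Data.Integer as ℤ using (ℤ; +_; 0ℤ; 1ℤ)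
open import Data.Fin as F using (Fin; toℕ; fromℕ; inject₁)
open import Data.Fin.Subset using (Subset; _∈_; _⊆_; ∣_∣)
open import Data.List as L using (List; []; _∷_)
open import Data.Vec as V using (Vec; []; _∷_; _∷ʳ_)
open import Data.Maybe as M using (Maybe; just; nothing)
open import Data.Bool using (Bool; true; false; not)
open import Data.Product using (Σ; ∃; _×_; _,_; proj₁; proj₂)
open import Data.Sum as Sum using (_⊎_; inj₁; inj₂; [_,_]′)
open import Data.Empty using (⊥; ⊥-elim)
open import Function using (_∘_; id; _⇔_; mk⇔)
open import Relation.Nullary using (Dec; yes; no; does; ¬_; contradiction)
open import Relation.Nullary.Decidable using (_×-dec_; _→-dec_; ¬?; map′; does-⇔; dec-true; True; toWitness; fromWitness)
open import Relation.Binary.PropositionalEquality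
import Data.Nat.Properties as ℕP
import Data.Nat.DivMod as ℕD
import Data.Nat.Tactic.RingSolver as ℕSolver
import Data.Integer.Properties as ℤP
import Data.Integer.Tactic.RingSolver as ℤSolver
import Data.Fin.Properties as FP
import Data.Fin.Subset.Properties as SP
import Data.Vec.Properties as VP
import Data.Maybe.Properties as MP

-- Integral cochains on joins and on words, and pullback through barycentric subdivision.

module Subdivision where
  open import Data.Integer using (_+_; _*_; _-_; -_)
  open ℤSolver using (solve-∀)

  -- `ext` is a field because functionals get applied to functions that agree only pointwise. The
  -- single law `lin` yields sums, differences and multiples.
  record Linear {A : Set} (T : (A → ℤ) → ℤ) : Set where
    field
      ext : ∀ {f g} → (∀ a → f a ≡ g a) → T f ≡ T g
      lin : ∀ c f g → T (λ a → f a + c * g a) ≡ T f + c * T g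

    zer : T (λ _ → 0ℤ) ≡ 0ℤ
    zer = trans (ext (λ _ → refl)) (trans (lin (- 1ℤ) (λ _ → 0ℤ) (λ _ → 0ℤ)) (cancel (T (λ _ → 0ℤ))))
      where cancel : ∀ x → x + (- 1ℤ) * x ≡ 0ℤ
            cancel = solve-∀

    sub : ∀ f g → T (λ a → f a - g a) ≡ T f - T g
    sub f g = trans (ext (λ a → eq (f a) (g a))) (trans (lin (- 1ℤ) f g) (sym (eq (T f) (T g))))
      where eq : ∀ x y → x - y ≡ x + (- 1ℤ) * y
            eq = solve-∀

    add : ∀ f g → T (λ a → f a + g a) ≡ T f + T g
    add f g = trans (ext (λ a → eq (f a) (g a))) (trans (lin 1ℤ f g) (sym (eq (T f) (T g))))
      where eq : ∀ x y → x + y ≡ x + 1ℤ * y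
            eq = solve-∀

    scale : ∀ c g → T (λ a → c * g a) ≡ c * T g
    scale c g = trans (ext (λ a → sym (ℤP.+-identityˡ _)))
      (trans (lin c (λ _ → 0ℤ) g) (trans (cong (_+ c * T g) zer) (ℤP.+-identityˡ _)))

  open Linear

  Operator : Set → Set → Set
  Operator A B = (A → ℤ) → B → ℤ

  LinearOp : ∀ {A B} → Operator A B → Set
  LinearOp T = ∀ b → Linear (λ f → T f b)

  ∘-linear : ∀ {A B} {S : (B → ℤ) → ℤ} {T : Operator A B} →
    Linear S → LinearOp T → Linear (λ f → S (T f))
  ∘-linear {S = S} {T} LS LT = record
    { ext = λ eq → ext LS (λ b → ext (LT b) eq)
    ; lin = λ c f g → trans (ext LS (λ b → lin (LT b) c f g)) (lin LS c (T f) (T g)) }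

  pullback-linear : ∀ {A B : Set} (h : B → A) → LinearOp (λ f → f ∘ h)
  pullback-linear h b = record { ext = λ eq → eq (h b) ; lin = λ _ _ _ → refl }

  zero-linear : ∀ {A} → Linear {A} (λ _ → 0ℤ)
  zero-linear = record { ext = λ _ → refl ; lin = λ c _ _ → eq c }
    where eq : ∀ c → 0ℤ ≡ 0ℤ + c * 0ℤ
          eq = solve-∀

  sub-linear : ∀ {A} {S T : (A → ℤ) → ℤ} → Linear S → Linear T → Linear (λ f → S f - T f)
  sub-linear {S = S} {T} LS LT = record
    { ext = λ eq → cong₂ _-_ (ext LS eq) (ext LT eq)
    ; lin = λ c f g → trans (cong₂ _-_ (lin LS c f g) (lin LT c f g)) (eq (S f) (T f) c (S g) (T g)) }
    where eq : ∀ x y c u v → (x + c * u) - (y + c * v) ≡ (x - y) + c * (u - v)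
          eq = solve-∀

  add-linear : ∀ {A} {S T : (A → ℤ) → ℤ} → Linear S → Linear T → Linear (λ f → S f + T f)
  add-linear {S = S} {T} LS LT = record
    { ext = λ eq → cong₂ _+_ (ext LS eq) (ext LT eq)
    ; lin = λ c f g → trans (cong₂ _+_ (lin LS c f g) (lin LT c f g)) (eq (S f) (T f) c (S g) (T g)) }
    where eq : ∀ x y c u v → (x + c * u) + (y + c * v) ≡ (x + y) + c * (u + v)
          eq = solve-∀

  Signed : ℕ → ℕ → Set
  Signed p n = Vec (Maybe (Fin p)) n

  -- The deleted sign `a` is recorded so that its class can be counted later. A proof of
  -- `Face a Y X` also certifies that `X` is not the zero vector.
  data Face {p : ℕ} (a : Fin p) : ∀ {n} → Signed p n → Signed p n → Set where
    here  : ∀ {n} {X : Signed p n} → Face a (nothing ∷ X) (just a ∷ X)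
    there : ∀ {n x} {Y X : Signed p n} → Face a Y X → Face a (x ∷ Y) (x ∷ X)

  -- The simplicial coboundary of the n-fold join of p points; X is a simplex (empty if all nothing).
  D : ∀ {p n} → Operator (Signed p n) (Signed p n)
  D f []            = 0ℤ
  D f (nothing ∷ X) = D (f ∘ (nothing ∷_)) X
  D f (just a ∷ X)  = f (nothing ∷ X) - D (f ∘ (just a ∷_)) X

  D-linear : ∀ {p n} → LinearOp (D {p} {n})
  D-linear []            = zero-linear
  D-linear (nothing ∷ X) = ∘-linear (D-linear X) (pullback-linear (nothing ∷_))
  D-linear (just a ∷ X)  = sub-linear (pullback-linear (nothing ∷_) X)
    (∘-linear (D-linear X) (pullback-linear (just a ∷_)))

  -- Allows hypotheses on labels to be restricted to pairs `Face a Y X`, so that nothing is asked of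
  -- the zero vector.
  D-local : ∀ {p n} {f g : Signed p n → ℤ} (X : Signed p n) →
    (∀ a Y → Face a Y X → f Y ≡ g Y) → D f X ≡ D g X
  D-local []            eq = refl
  D-local (nothing ∷ X) eq = D-local X (λ a Y F → eq a _ (there F))
  D-local (just a ∷ X)  eq =
    cong₂ _-_ (eq a _ here) (D-local X (λ b Y F → eq b _ (there F)))

  D-vanish : ∀ {p n} {f : Signed p n → ℤ} (X : Signed p n) →
    (∀ a Y → Face a Y X → f Y ≡ 0ℤ) → D f X ≡ 0ℤ
  D-vanish X eq = trans (D-local X eq) (zer (D-linear X))

  DD≡0 : ∀ {p n} (f : Signed p n → ℤ) X → D (D f) X ≡ 0ℤ
  DD≡0 f []            = refl
  DD≡0 f (nothing ∷ X) = DD≡0 (f ∘ (nothing ∷_)) X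
  DD≡0 f (just a ∷ X)  = begin
    Df₀ - D (λ Y → f (nothing ∷ Y) - D f₁ Y) X ≡⟨ cong (λ z → Df₀ - z) (sub (D-linear X) _ _) ⟩
    Df₀ - (Df₀ - D (D f₁) X)                   ≡⟨ cong (λ z → Df₀ - (Df₀ - z)) (DD≡0 f₁ X) ⟩
    Df₀ - (Df₀ - 0ℤ)                           ≡⟨ eq Df₀ ⟩
    0ℤ                                         ∎
    where
    open ≡-Reasoning
    f₁  = f ∘ (just a ∷_)
    Df₀ = D (f ∘ (nothing ∷_)) X
    eq : ∀ x → x - (x - 0ℤ) ≡ 0ℤ
    eq = solve-∀

  Cochain : Set
  Cochain = List ℕ → ℤ

  -- Cochains of the simplex on the vertex set ℕ: faces omit one letter of a word.
  δ : Cochain → Cochain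
  δ α []      = 0ℤ
  δ α (x ∷ w) = α w - δ (α ∘ (x ∷_)) w

  δ-linear : LinearOp δ
  δ-linear []      = zero-linear
  δ-linear (x ∷ w) = sub-linear (pullback-linear id w) (∘-linear (δ-linear w) (pullback-linear (x ∷_)))

  -- Pullback along s of a cochain on words of length d, through barycentric subdivision: the
  -- subdivision of X is the cone, with apex X, over the subdivision of its boundary.
  P : ∀ {p n} → (Signed p n → ℕ) → ℕ → Operator (List ℕ) (Signed p n)
  P s zero    α X = α []
  P s (suc d) α X = D (P s d (α ∘ (s X ∷_))) X

  P-linear : ∀ {p n} (s : Signed p n → ℕ) d → LinearOp (P s d)
  P-linear s zero    X = pullback-linear (λ (_ : Signed _ _) → []) X
  P-linear s (suc d) X =
    ∘-linear (D-linear X) (λ Y → ∘-linear (P-linear s d Y) (pullback-linear (s X ∷_)))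

  -- The pullback is a cochain map. Omitting the apex label gives the right-hand side; by induction
  -- the other faces contribute `D` applied twice, which is 0.
  P-δ : ∀ {p n} (s : Signed p n → ℕ) d α X → P s (suc d) (δ α) X ≡ D (P s d α) X
  P-δ s zero α X = ext (D-linear X) (λ _ → ℤP.+-identityʳ (α []))
  P-δ s (suc d) α X = begin
    D (P s (suc d) (λ w → α w - δ αₓ w)) X
      ≡⟨ ext (D-linear X) (λ Y → sub (P-linear s (suc d) Y) α (δ αₓ)) ⟩
    D (λ Y → P s (suc d) α Y - P s (suc d) (δ αₓ) Y) X
      ≡⟨ sub (D-linear X) _ _ ⟩
    D (P s (suc d) α) X - D (P s (suc d) (δ αₓ)) X
      ≡⟨ cong (λ z → D (P s (suc d) α) X - z)
           (trans (ext (D-linear X) (P-δ s d αₓ)) (DD≡0 (P s d αₓ) X)) ⟩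
    D (P s (suc d) α) X - 0ℤ
      ≡⟨ ℤP.+-identityʳ _ ⟩
    D (P s (suc d) α) X ∎
    where
    open ≡-Reasoning
    αₓ = α ∘ (s X ∷_)

  P-nothing : ∀ {p n} (s : Signed p (suc n) → ℕ) d α X →
    P s d α (nothing ∷ X) ≡ P (s ∘ (nothing ∷_)) d α X
  P-nothing s zero    α X = refl
  P-nothing s (suc d) α X = ext (D-linear X) (λ Y → P-nothing s d (α ∘ (s (nothing ∷ X) ∷_)) Y)

  data Repeats : List ℕ → Set where
    here  : ∀ {x w} → Repeats (x ∷ x ∷ w)
    there : ∀ {x w} → Repeats w → Repeats (x ∷ w)

  Normalised : Cochain → Set
  Normalised α = ∀ w → Repeats w → α w ≡ 0ℤ

  -- `P s d α X` evaluates `α` on label words of descending chains of d nonzero vectors starting at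
  -- `X`. Without an adjacent repeat, `ℓ` drops d - 1 times and ends at 1 or more, which forces
  -- `ℓ X` to be at least d.
  P-vanish : ∀ {p n} (s ℓ : Signed p n → ℕ) →
    (∀ {a Y X} → Face a Y X → 1 ℕ.≤ ℓ X) →
    (∀ {a Y X} → Face a Y X → ℓ Y ℕ.< ℓ X ⊎ s Y ≡ s X) →
    ∀ d α → Normalised α → ∀ X → ℓ X ℕ.< d → P s d α X ≡ 0ℤ
  P-vanish s ℓ pos drop (suc zero) α nα X (s≤s ℓX≤0) =
    D-vanish X (λ a Y F → ⊥-elim (ℕP.<⇒≱ (pos F) ℓX≤0))
  P-vanish s ℓ pos drop (suc (suc d)) α nα X (s≤s ℓX≤d) = D-vanish X λ a Y F →
    [ (λ ℓY<ℓX → P-vanish s ℓ pos drop (suc d) (α ∘ (s X ∷_)) (λ w r → nα _ (there r)) Y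
        (ℕP.<-≤-trans ℓY<ℓX ℓX≤d))
    , (λ sY≡sX → D-vanish Y λ _ Z _ →
        trans (ext (P-linear s d Z) (λ w → nα (s X ∷ s Y ∷ w)
          (subst (λ y → Repeats (s X ∷ y ∷ w)) (sym sY≡sX) here)))
        (zer (P-linear s d Z)))
    ]′ (drop F)

-- Residues modulo p and the cyclic shift of signs.

module Residues (m : ℕ) where
  open import Data.Nat using (_+_; _*_; _<_)
  open ℕSolver using (solve-∀)

  p : ℕ
  p = suc m

  infix 4 _≋_
  _≋_ : ℕ → ℕ → Set
  a ≋ b = a % p ≡ b % p

  +-≋ : ∀ a b c d → a ≋ b → c ≋ d → a + c ≋ b + d
  +-≋ a b c d ab cd = trans (ℕD.%-distribˡ-+ a c p)
    (trans (cong₂ (λ x y → (x + y) % p) ab cd) (sym (ℕD.%-distribˡ-+ b d p)))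

  *-≋ : ∀ a b c d → a ≋ b → c ≋ d → a * c ≋ b * d
  *-≋ a b c d ab cd = trans (ℕD.%-distribˡ-* a c p)
    (trans (cong₂ (λ x y → (x * y) % p) ab cd) (sym (ℕD.%-distribˡ-* b d p)))

  %-≋ : ∀ a → a % p ≋ a
  %-≋ a = ℕD.m%n%n≡m%n a p

  +p≋ : ∀ a b → a + b * p ≋ a
  +p≋ a b = ℕD.[m+kn]%n≡m%n a b p

  -- Adding `m * c` completes `c` to the multiple `c * p`, which avoids subtraction.
  ≋-cancelʳ : ∀ a b c → a + c ≋ b + c → a ≋ b
  ≋-cancelʳ a b c eq = begin
    a % p                       ≡⟨ sym (+p≋ a c) ⟩
    (a + c * p) % p         ≡⟨ cong (_% p) (arr a c m) ⟩
    (a + c + m * c) % p   ≡⟨ +-≋ (a + c) (b + c) (m * c) (m * c) eq refl ⟩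
    (b + c + m * c) % p   ≡⟨ cong (_% p) (sym (arr b c m)) ⟩
    (b + c * p) % p         ≡⟨ +p≋ b c ⟩
    b % p                       ∎
    where
    open ≡-Reasoning
    arr : ∀ a c m → a + c * suc m ≡ a + c + m * c
    arr = solve-∀

  ρ : Fin p → Fin p
  ρ F.zero    = fromℕ m
  ρ (F.suc i) = inject₁ i

  toℕ-ρ : ∀ a → suc (toℕ (ρ a)) ≋ toℕ a
  toℕ-ρ F.zero    = trans (cong (λ x → suc x % p) (FP.toℕ-fromℕ m)) (ℕD.n%n≡0 p)
  toℕ-ρ (F.suc i) = cong (λ x → suc x % p) (FP.toℕ-inject₁ i)

  toℕ-ρ^ : ∀ a j → toℕ (fold a ρ j) + j ≋ toℕ a
  toℕ-ρ^ a zero    = cong (_% p) (ℕP.+-identityʳ (toℕ a))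
  toℕ-ρ^ a (suc j) = trans (cong (_% p) (ℕP.+-suc (toℕ (fold a ρ (suc j))) j))
    (trans (+-≋ (suc (toℕ (fold a ρ (suc j)))) (toℕ (fold a ρ j)) j j (toℕ-ρ (fold a ρ j)) refl) (toℕ-ρ^ a j))

  toℕ-≋-injective : ∀ {a b : Fin p} → toℕ a ≋ toℕ b → a ≡ b
  toℕ-≋-injective {a} {b} eq = FP.toℕ-injective
    (trans (sym (ℕD.m<n⇒m%n≡m (FP.toℕ<n a))) (trans eq (ℕD.m<n⇒m%n≡m (FP.toℕ<n b))))

  ρ-injective : ∀ {a b} → ρ a ≡ ρ b → a ≡ b
  ρ-injective {a} {b} eq = toℕ-≋-injective
    (trans (sym (toℕ-ρ a)) (trans (cong (λ c → suc (toℕ c) % p) eq) (toℕ-ρ b)))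

  ρ^p : ∀ a → fold a ρ p ≡ a
  ρ^p a = toℕ-≋-injective (trans (sym (ℕD.[m+n]%n≡m%n (toℕ (fold a ρ p)) p)) (toℕ-ρ^ a p))

  -- The action is free: the i-th iterate plus i is congruent to `a`, so equal iterates have
  -- congruent exponents, and both exponents are below p.
  ρ^-injective : ∀ a i j → i < p → j < p → fold a ρ i ≡ fold a ρ j → i ≡ j
  ρ^-injective a i j i<p j<p eq =
    trans (sym (ℕD.m<n⇒m%n≡m i<p)) (trans (≋-cancelʳ i j (toℕ (fold a ρ i)) i+≋j+) (ℕD.m<n⇒m%n≡m j<p))
    where
    i+≋j+ : i + toℕ (fold a ρ i) ≋ j + toℕ (fold a ρ i)
    i+≋j+ = trans (cong (_% p) (ℕP.+-comm i _)) (trans (toℕ-ρ^ a i)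
      (trans (sym (toℕ-ρ^ a j)) (trans (cong (λ b → (toℕ b + j) % p) (sym eq))
        (cong (_% p) (ℕP.+-comm _ j)))))

  fold-comm : ∀ {A : Set} (f : A → A) x j → fold (f x) f j ≡ f (fold x f j)
  fold-comm f x zero    = refl
  fold-comm f x (suc j) = cong f (fold-comm f x j)

  -- ρ lowers signs whereas rot raises labels; this fits s(X) = - (the centre).
  rot : ℕ → ℕ
  rot a = suc a % p

-- The action of ℤ/p on sign vectors and equivariant labellings.

module Tucker (m : ℕ) where
  open import Data.Integer using (_+_; _*_; _-_; -_)
  open ℤSolver using (solve-∀)
  open Subdivision
  open Linear
  open Residues m

  ρ* : ∀ {n} → Signed p n → Signed p n
  ρ* = V.map (M.map ρ)

  fold-ρ*-nothing : ∀ {n} (X : Signed p n) j → fold (nothing ∷ X) ρ* j ≡ nothing ∷ fold X ρ* j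
  fold-ρ*-nothing X zero    = refl
  fold-ρ*-nothing X (suc j) = cong ρ* (fold-ρ*-nothing X j)

  fold-ρ*-just : ∀ {n} a (X : Signed p n) j → fold (just a ∷ X) ρ* j ≡ just (fold a ρ j) ∷ fold X ρ* j
  fold-ρ*-just a X zero    = refl
  fold-ρ*-just a X (suc j) = cong ρ* (fold-ρ*-just a X j)

  fold-[] : ∀ j → fold [] (ρ* {0}) j ≡ []
  fold-[] zero = refl
  fold-[] (suc j) = cong ρ* (fold-[] j)

  ρ*^p : ∀ {n} (X : Signed p n) → fold X ρ* p ≡ X
  ρ*^p []            = fold-[] p
  ρ*^p (nothing ∷ X) = trans (fold-ρ*-nothing X p) (cong (nothing ∷_) (ρ*^p X))
  ρ*^p (just a ∷ X)  = trans (fold-ρ*-just a X p) (cong₂ (λ b Y → just b ∷ Y) (ρ^p a) (ρ*^p X))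

  D-ρ* : ∀ {n} (f : Signed p n → ℤ) X → D f (ρ* X) ≡ D (f ∘ ρ*) X
  D-ρ* f []            = refl
  D-ρ* f (nothing ∷ X) = D-ρ* (f ∘ (nothing ∷_)) X
  D-ρ* f (just a ∷ X)  = cong (λ z → f (nothing ∷ ρ* X) - z) (D-ρ* (f ∘ (just (ρ a) ∷_)) X)

  Equivariant : ∀ {n} → (Signed p n → ℕ) → Set
  Equivariant s = ∀ {a Y X} → Face a Y X → s (ρ* X) ≡ rot (s X)

  -- Moves the symmetry from vectors to labels; in particular, invariant cochains pull back to
  -- invariant functions.
  P-ρ* : ∀ {n} {s : Signed p n → ℕ} → Equivariant s → ∀ d α X →
    P s d α (ρ* X) ≡ P s d (α ∘ L.map rot) X
  P-ρ* eqv zero    α X = refl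
  P-ρ* {s = s} eqv (suc d) α X = trans (D-ρ* (P s d (α ∘ (s (ρ* X) ∷_))) X) (D-local X λ a Y F →
    trans (P-ρ* eqv d (α ∘ (s (ρ* X) ∷_)) Y)
      (ext (P-linear s d Y) (λ w → cong (λ x → α (x ∷ L.map rot w)) (eqv F))))

  -- Orbit sums and the periodic resolution of ℤ/p.

  Σ< : ℕ → (ℕ → ℤ) → ℤ
  Σ< zero    f = 0ℤ
  Σ< (suc n) f = Σ< n f + f n

  Σ<-cong : ∀ n {f g} → (∀ j → f j ≡ g j) → Σ< n f ≡ Σ< n g
  Σ<-cong zero    eq = refl
  Σ<-cong (suc n) eq = cong₂ _+_ (Σ<-cong n eq) (eq n)

  Σ<-const : ∀ n c → Σ< n (λ _ → c) ≡ + n * c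
  Σ<-const zero    c = refl
  Σ<-const (suc n) c = trans (cong (_+ c) (Σ<-const n c)) (trans (ℤP.+-comm (+ n * c) c) (sym (ℤP.suc-* (+ n) c)))

  Σ<-telescope : ∀ n (f : ℕ → ℤ) → Σ< n (λ j → f (suc j) - f j) ≡ f n - f 0
  Σ<-telescope zero    f = sym (ℤP.+-inverseʳ (f 0))
  Σ<-telescope (suc n) f = trans (cong (_+ (f (suc n) - f n)) (Σ<-telescope n f)) (eq (f (suc n)) (f n) (f 0))
    where eq : ∀ x y z → (y - z) + (x - y) ≡ x - z
          eq = solve-∀

  Σ<-sub : ∀ n (f g : ℕ → ℤ) → Σ< n (λ j → f j - g j) ≡ Σ< n f - Σ< n g
  Σ<-sub zero    f g = refl
  Σ<-sub (suc n) f g = trans (cong (_+ (f n - g n)) (Σ<-sub n f g)) (eq (Σ< n f) (Σ< n g) (f n) (g n))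
    where eq : ∀ x y z w → (x - y) + (z - w) ≡ (x + z) - (y + w)
          eq = solve-∀

  Σ<-linear : ∀ {A} n {T : ℕ → (A → ℤ) → ℤ} → (∀ j → Linear (T j)) → Linear (λ f → Σ< n (λ j → T j f))
  Σ<-linear zero    LT = zero-linear
  Σ<-linear (suc n) LT = add-linear (Σ<-linear n LT) (LT n)

  -- ρ - 1 and the norm 1 + ρ + … + ρ^{p-1}, the two differentials of the periodic resolution.
  τ : ∀ {n} → Bool → Operator (Signed p n) (Signed p n)
  τ false f X = f (ρ* X) - f X
  τ true  f X = Σ< p (λ j → f (fold X ρ* j))

  τ-linear : ∀ {n} b → LinearOp (τ {n} b)
  τ-linear false X = sub-linear (pullback-linear ρ* X) (pullback-linear id X)
  τ-linear true  X = Σ<-linear p (λ j → pullback-linear (λ Y → fold Y ρ* j) X)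

  Σ-orbit-boundary : ∀ {n} (f : Signed p n → ℤ) X →
    Σ< p (λ j → f (fold X ρ* (suc j)) - f (fold X ρ* j)) ≡ 0ℤ
  Σ-orbit-boundary f X = trans (Σ<-telescope p (λ j → f (fold X ρ* j)))
    (trans (cong (λ Y → f Y - f X) (ρ*^p X)) (ℤP.+-inverseʳ (f X)))

  ττ≡0 : ∀ {n} b (f : Signed p n → ℤ) X → τ b (τ (not b) f) X ≡ 0ℤ
  ττ≡0 true  f X = Σ-orbit-boundary f X
  ττ≡0 false f X = trans (sym (Σ<-sub p _ _)) (trans
    (Σ<-cong p (λ j → cong (λ Y → f Y - f (fold X ρ* j)) (fold-comm ρ* X j))) (Σ-orbit-boundary f X))

  D-fold : ∀ {n} (f : Signed p n → ℤ) j X → D f (fold X ρ* j) ≡ D (λ Y → f (fold Y ρ* j)) X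
  D-fold f zero    X = refl
  D-fold f (suc j) X = trans (D-ρ* f (fold X ρ* j)) (D-fold (f ∘ ρ*) j X)

  D-Σ< : ∀ {n} k (f : ℕ → Signed p n → ℤ) X → D (λ Y → Σ< k (λ j → f j Y)) X ≡ Σ< k (λ j → D (f j) X)
  D-Σ< zero    f X = zer (D-linear X)
  D-Σ< (suc k) f X = trans (add (D-linear X) _ _) (cong (_+ D (f k) X) (D-Σ< k f X))

  D-τ : ∀ {n} b (f : Signed p n → ℤ) X → τ b (D f) X ≡ D (τ b f) X
  D-τ false f X = trans (cong (_- D f X) (D-ρ* f X)) (sym (sub (D-linear X) (f ∘ ρ*) f))
  D-τ true  f X = trans (Σ<-cong p (λ j → D-fold f j X)) (sym (D-Σ< p (λ j Y → f (fold Y ρ* j)) X))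

  -- Evaluation on the iterated cones, and Stokes' formula.

  parity : ℕ → Bool
  parity zero    = false
  parity (suc n) = not (parity n)

  -- Evaluation on a chain hₙ with ∂hₙ₊₁ = τ hₙ, built as the cone hₙ₊₁ = [0] * τ hₙ.
  H : ∀ n → (Signed p (suc n) → ℤ) → ℤ
  H zero    f = f (just F.zero ∷ [])
  H (suc n) f = H n (τ (parity n) (f ∘ (just F.zero ∷_)))

  H-linear : ∀ n → Linear (H n)
  H-linear zero    = pullback-linear id _
  H-linear (suc n) = ∘-linear (H-linear n)
    (λ X → ∘-linear (τ-linear (parity n) X) (pullback-linear (just F.zero ∷_)))

  τ-nothing : ∀ {n} b (f : Signed p (suc n) → ℤ) X → τ b f (nothing ∷ X) ≡ τ b (f ∘ (nothing ∷_)) X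
  τ-nothing false f X = refl
  τ-nothing true  f X = Σ<-cong p (λ j → cong f (fold-ρ*-nothing X j))

  -- This says that `τ hₙ` is a cycle: `τ` commutes with the boundary, the boundary of `hₙ` is the
  -- other `τ` of the previous chain, and the two kinds of `τ` compose to 0. The induction
  -- alternates with `stokes`.
  H-τD : ∀ n f → H n (τ (parity n) (D f)) ≡ 0ℤ

  -- The boundary of a cone is its base minus the cone over the boundary of the base, and the base
  -- `τ hₙ` is a cycle by `H-τD`.
  stokes : ∀ n f → H (suc n) (D f) ≡ H n (τ (parity n) (f ∘ (nothing ∷_)))
  stokes n f = begin
    H n (τ b (λ X → f (nothing ∷ X) - D f₁ X))   ≡⟨ ext (H-linear n) (λ X → sub (τ-linear b X) _ _) ⟩
    H n (λ X → τ b f₀ X - τ b (D f₁) X)          ≡⟨ sub (H-linear n) _ _ ⟩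
    H n (τ b f₀) - H n (τ b (D f₁))              ≡⟨ cong (λ z → H n (τ b f₀) - z) (H-τD n f₁) ⟩
    H n (τ b f₀) - 0ℤ                            ≡⟨ ℤP.+-identityʳ _ ⟩
    H n (τ b f₀)                                 ∎
    where
    open ≡-Reasoning
    b  = parity n
    f₀ = f ∘ (nothing ∷_)
    f₁ = f ∘ (just F.zero ∷_)

  -- Both vertices have the empty simplex as their only face, so the difference cancels.
  H-τD zero f = ℤP.+-inverseʳ (f (nothing ∷ []) - 0ℤ)
  H-τD (suc n) f = begin
    H (suc n) (τ b (D f))                      ≡⟨ ext (H-linear (suc n)) (D-τ b f) ⟩
    H (suc n) (D (τ b f))                      ≡⟨ stokes n (τ b f) ⟩
    H n (τ (parity n) (τ b f ∘ (nothing ∷_)))  ≡⟨ ext (H-linear n) (λ X → trans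
        (ext (τ-linear (parity n) X) (τ-nothing b f)) (ττ≡0 (parity n) (f ∘ (nothing ∷_)) X)) ⟩
    H n (λ _ → 0ℤ)                             ≡⟨ zer (H-linear n) ⟩
    0ℤ                                         ∎
    where
    open ≡-Reasoning
    b = parity (suc n)

  -- Cocycles on words of residues.

  -- The residue of b - a, written without subtraction.
  u : ℕ → ℕ → ℕ
  u a b = (b ℕ.+ m ℕ.* a) % p

  u-rot : ∀ a b → u (rot a) (rot b) ≡ u a b
  u-rot a b = trans (+-≋ (rot b) (suc b) (m ℕ.* rot a) (m ℕ.* suc a) (%-≋ (suc b))
    (*-≋ m m (rot a) (suc a) refl (%-≋ (suc a))))
    (trans (cong (_% p) (arr a b m)) (+p≋ (b ℕ.+ m ℕ.* a) 1))
    where arr : ∀ a b m → suc b ℕ.+ m ℕ.* suc a ≡ b ℕ.+ m ℕ.* a ℕ.+ 1 ℕ.* suc m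
          arr = ℕSolver.solve-∀

  u-diag : ∀ a → u a a ≡ 0
  u-diag a = trans (cong (_% p) (ℕP.*-comm p a)) (ℕD.m*n%n≡0 a p)

  -- The carry cocycle of the extension ℤ → ℤ → ℤ/p.
  β : ℕ → ℕ → ℕ → ℕ
  β a b c = (u a b ℕ.+ u b c) / p

  u+u : ∀ a b c → u a b ℕ.+ u b c ≡ u a c ℕ.+ β a b c ℕ.* p
  u+u a b c = trans (ℕD.m≡m%n+[m/n]*n (u a b ℕ.+ u b c) p) (cong (ℕ._+ β a b c ℕ.* p)
    (trans (+-≋ (u a b) (b ℕ.+ m ℕ.* a) (u b c) (c ℕ.+ m ℕ.* b) (%-≋ (b ℕ.+ m ℕ.* a)) (%-≋ (c ℕ.+ m ℕ.* b)))
      (trans (cong (_% p) (arr a b c m)) (+p≋ (c ℕ.+ m ℕ.* a) b))))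
    where arr : ∀ a b c m → b ℕ.+ m ℕ.* a ℕ.+ (c ℕ.+ m ℕ.* b) ≡ c ℕ.+ m ℕ.* a ℕ.+ b ℕ.* suc m
          arr = ℕSolver.solve-∀

  u<p : ∀ a b → u a b ℕ.< p
  u<p a b = ℕD.m%n<n (b ℕ.+ m ℕ.* a) p

  β-diagˡ : ∀ a c → β a a c ≡ 0
  β-diagˡ a c = trans (cong (λ x → (x ℕ.+ u a c) / p) (u-diag a)) (ℕD.m<n⇒m/n≡0 (u<p a c))

  β-diagʳ : ∀ a c → β a c c ≡ 0
  β-diagʳ a c = trans (cong (λ x → (u a c ℕ.+ x) / p) (u-diag c))
    (trans (cong (_/ p) (ℕP.+-identityʳ (u a c))) (ℕD.m<n⇒m/n≡0 (u<p a c)))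

  β-rot : ∀ a b c → β (rot a) (rot b) (rot c) ≡ β a b c
  β-rot a b c = cong₂ (λ x y → (x ℕ.+ y) / p) (u-rot a b) (u-rot b c)

  -- Over ℤ the coboundary of `u` is p times the carry; the nested signs are those that `δ`
  -- produces.
  pβ : ∀ a b c → + p * + β a b c ≡ + u b c - (+ u a c - + u a b)
  pβ a b c = sym (eq (+ u a b) (+ u b c) (+ u a c) (+ p * + β a b c) step)
    where
    step : + u a b + + u b c ≡ + u a c + + p * + β a b c
    step = begin
      + u a b + + u b c              ≡⟨ sym (ℤP.pos-+ (u a b) (u b c)) ⟩
      + (u a b ℕ.+ u b c)            ≡⟨ cong +_ (u+u a b c) ⟩
      + (u a c ℕ.+ β a b c ℕ.* p)    ≡⟨ ℤP.pos-+ (u a c) _ ⟩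
      + u a c + + (β a b c ℕ.* p)    ≡⟨ cong (λ z → + u a c + z)
        (trans (cong +_ (ℕP.*-comm (β a b c) p)) (ℤP.pos-* p (β a b c))) ⟩
      + u a c + + p * + β a b c      ∎
      where open ≡-Reasoning
    arr₁ : ∀ x y z → y - (z - x) ≡ (x + y) - z
    arr₁ = solve-∀
    arr₂ : ∀ z w → (z + w) - z ≡ w
    arr₂ = solve-∀
    eq : ∀ x y z w → x + y ≡ z + w → y - (z - x) ≡ w
    eq x y z w h = trans (arr₁ x y z) (trans (cong (_- z) h) (arr₂ z w))

  -- p times `β` is a coboundary, hence closed, and p cancels in ℤ.
  β-cocycle : ∀ a b c d → + β b c d - (+ β a c d - (+ β a b d - + β a b c)) ≡ 0ℤ
  β-cocycle a b c d = ℤP.*-cancelˡ-≡ (+ p) _ _ (begin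
    + p * (+ β b c d - (+ β a c d - (+ β a b d - + β a b c)))
      ≡⟨ dist (+ p) (+ β b c d) (+ β a c d) (+ β a b d) (+ β a b c) ⟩
    + p * + β b c d - (+ p * + β a c d - (+ p * + β a b d - + p * + β a b c))
      ≡⟨ cong₂ _-_ (pβ b c d) (cong₂ _-_ (pβ a c d) (cong₂ _-_ (pβ a b d) (pβ a b c))) ⟩
    _ ≡⟨ eq (+ u c d) (+ u b d) (+ u b c) (+ u a d) (+ u a c) (+ u a b) ⟩
    0ℤ
      ≡⟨ sym (ℤP.*-zeroʳ (+ p)) ⟩
    + p * 0ℤ ∎)
    where
    open ≡-Reasoning
    dist : ∀ p x y z w → p * (x - (y - (z - w))) ≡ p * x - (p * y - (p * z - p * w))
    dist = solve-∀
    eq : ∀ cd bd bc ad ac ab →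
      (cd - (bd - bc)) - ((cd - (ad - ac)) - ((bd - (ad - ab)) - (bc - (ac - ab)))) ≡ 0ℤ
    eq = solve-∀

  -- e and o represent the powers of [β] and their products with the class of u.
  e : Cochain
  e []              = 0ℤ
  e (a ∷ [])        = 1ℤ
  e (a ∷ b ∷ [])    = 0ℤ
  e (a ∷ b ∷ c ∷ w) = + β a b c * e (c ∷ w)

  -- The junk value at [] makes δ o = p e hold for words of every length.
  o : Cochain
  o []          = + p
  o (a ∷ [])    = 0ℤ
  o (a ∷ b ∷ w) = + u a b * e (b ∷ w)

  contract-cocycle : ∀ α a w → δ α (a ∷ w) ≡ 0ℤ → δ (α ∘ (a ∷_)) w ≡ α w
  contract-cocycle α a w eq = sym (ℤP.i-j≡0⇒i≡j _ _ eq)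

  -- Leibniz rule for the leading factor `β`: faces omitting one of the first three letters contain
  -- `e (d ∷ w)`, the remaining faces sum by induction to `β a b c` times it, and the cocycle
  -- identity of `β` is left over.
  δe≡0 : ∀ w → δ e w ≡ 0ℤ
  δe≡0 []               = refl
  δe≡0 (a ∷ [])         = refl
  δe≡0 (a ∷ b ∷ [])     = refl
  δe≡0 (a ∷ b ∷ c ∷ []) = refl
  δe≡0 (a ∷ b ∷ c ∷ d ∷ w) = begin
    + β b c d * E - (+ β a c d * E - (+ β a b d * E - δ (λ v → + β a b c * e (c ∷ v)) (d ∷ w)))
      ≡⟨ cong (λ z → + β b c d * E - (+ β a c d * E - (+ β a b d * E - z)))
           (trans (scale (δ-linear (d ∷ w)) (+ β a b c) (e ∘ (c ∷_)))
             (cong (+ β a b c *_) (contract-cocycle e c (d ∷ w) (δe≡0 (c ∷ d ∷ w))))) ⟩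
    + β b c d * E - (+ β a c d * E - (+ β a b d * E - + β a b c * E))
      ≡⟨ dist (+ β b c d) (+ β a c d) (+ β a b d) (+ β a b c) E ⟩
    (+ β b c d - (+ β a c d - (+ β a b d - + β a b c))) * E
      ≡⟨ cong (_* E) (β-cocycle a b c d) ⟩
    0ℤ ∎
    where
    open ≡-Reasoning
    E = e (d ∷ w)
    dist : ∀ x y z t E → x * E - (y * E - (z * E - t * E)) ≡ (x - (y - (z - t))) * E
    dist = solve-∀

  δ-e-∷ : ∀ a b w → δ (e ∘ (a ∷_)) (b ∷ w) ≡ e (b ∷ w)
  δ-e-∷ a b w = contract-cocycle e a (b ∷ w) (δe≡0 (a ∷ b ∷ w))

  -- The Bockstein relation: `e` is closed, so only the coboundary of the factor `u` survives, and
  -- that is p times `β`.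
  δo≡pe : ∀ w → δ o w ≡ + p * e w
  δo≡pe []              = sym (ℤP.*-zeroʳ (+ p))
  δo≡pe (a ∷ [])        = trans (ℤP.+-identityʳ (+ p)) (sym (ℤP.*-identityʳ (+ p)))
  δo≡pe (a ∷ b ∷ [])    = sym (ℤP.*-zeroʳ (+ p))
  δo≡pe (a ∷ b ∷ c ∷ w) = begin
    + u b c * E - (+ u a c * E - δ (λ v → + u a b * e (b ∷ v)) (c ∷ w))
      ≡⟨ cong (λ z → + u b c * E - (+ u a c * E - z))
           (trans (scale (δ-linear (c ∷ w)) (+ u a b) (e ∘ (b ∷_))) (cong (+ u a b *_) (δ-e-∷ b c w))) ⟩
    + u b c * E - (+ u a c * E - + u a b * E)
      ≡⟨ dist (+ u b c) (+ u a c) (+ u a b) E ⟩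
    (+ u b c - (+ u a c - + u a b)) * E
      ≡⟨ cong (_* E) (sym (pβ a b c)) ⟩
    + p * + β a b c * E
      ≡⟨ ℤP.*-assoc (+ p) (+ β a b c) E ⟩
    + p * (+ β a b c * E) ∎
    where
    open ≡-Reasoning
    E = e (c ∷ w)
    dist : ∀ x y z E → x * E - (y * E - z * E) ≡ (x - (y - z)) * E
    dist = solve-∀

  -- A primitive of `o` modulo p. It is not invariant, because the first letter itself enters as an
  -- integer.
  re : Cochain
  re []      = 0ℤ
  re (a ∷ w) = + a * e (a ∷ w)

  -- The coefficient is the error of replacing b - a by its residue `u a b`, divided by p. The value
  -- at the empty word compensates `o []`.
  carry : Cochain
  carry (a ∷ b ∷ w) = (+ ((b ℕ.+ m ℕ.* a) / p) - + a) * e (b ∷ w)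
  carry (a ∷ [])    = 0ℤ
  carry []          = - 1ℤ

  pos-divMod : ∀ a → + a ≡ + (a % p) + + p * + (a / p)
  pos-divMod a = trans (cong +_ (ℕD.m≡m%n+[m/n]*n a p)) (trans (ℤP.pos-+ (a % p) _)
    (cong (λ z → + (a % p) + z) (trans (ℤP.pos-* (a / p) p) (ℤP.*-comm (+ (a / p)) (+ p)))))

  δre≡o+pcarry : ∀ w → δ re w ≡ o w + + p * carry w
  δre≡o+pcarry []          = sym (trans (cong (λ z → + p + z) (ℤP.*-comm (+ p) (- 1ℤ)))
    (trans (cong (λ z → + p + z) (ℤP.-1*i≡-i (+ p))) (ℤP.+-inverseʳ (+ p))))
  δre≡o+pcarry (a ∷ [])    = sym (trans (ℤP.+-identityˡ _) (ℤP.*-zeroʳ (+ p)))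
  δre≡o+pcarry (a ∷ b ∷ w) = begin
    + b * E - δ (λ v → + a * e (a ∷ v)) (b ∷ w)
      ≡⟨ cong (λ z → + b * E - z)
           (trans (scale (δ-linear (b ∷ w)) (+ a) (e ∘ (a ∷_))) (cong (+ a *_) (δ-e-∷ a b w))) ⟩
    + b * E - + a * E
      -- Writes b - a as (b + m a) - p a, so that division with remainder produces `u a b`.
      ≡⟨ arr₁ (+ a) (+ b) (+ m) E ⟩
    ((+ b + + m * + a) - (1ℤ + + m) * + a) * E
      ≡⟨ cong (λ z → (z - + p * + a) * E) (trans (cong (λ z → + b + z) (sym (ℤP.pos-* m a)))
           (trans (sym (ℤP.pos-+ b (m ℕ.* a))) (pos-divMod (b ℕ.+ m ℕ.* a)))) ⟩
    (+ u a b + + p * + ((b ℕ.+ m ℕ.* a) / p) - + p * + a) * E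
      ≡⟨ arr₂ (+ u a b) (+ p) (+ ((b ℕ.+ m ℕ.* a) / p)) (+ a) E ⟩
    + u a b * E + + p * ((+ ((b ℕ.+ m ℕ.* a) / p) - + a) * E) ∎
    where
    open ≡-Reasoning
    E = e (b ∷ w)
    arr₁ : ∀ a b m E → b * E - a * E ≡ ((b + m * a) - (1ℤ + m) * a) * E
    arr₁ = solve-∀
    arr₂ : ∀ u p q a E → (u + p * q - p * a) * E ≡ u * E + p * ((q - a) * E)
    arr₂ = solve-∀

  e-rot : ∀ w → e (L.map rot w) ≡ e w
  e-rot []              = refl
  e-rot (a ∷ [])        = refl
  e-rot (a ∷ b ∷ [])    = refl
  e-rot (a ∷ b ∷ c ∷ w) = cong₂ (λ x y → + x * y) (β-rot a b c) (e-rot (c ∷ w))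

  o-rot : ∀ w → o (L.map rot w) ≡ o w
  o-rot []          = refl
  o-rot (a ∷ [])    = refl
  o-rot (a ∷ b ∷ w) = cong₂ (λ x y → + x * y) (u-rot a b) (e-rot (b ∷ w))

  wrap : Cochain
  wrap []      = 0ℤ
  wrap (a ∷ w) = + (suc a / p) * e (a ∷ w)

  -- `rot` adds 1 to the first letter up to a multiple of p, recorded by `wrap`, while `e` is
  -- invariant.
  re-rot : ∀ w → re (L.map rot w) ≡ re w + e w + (- + p) * wrap w
  re-rot []      = sym (trans (ℤP.+-identityˡ _) (ℤP.*-zeroʳ (- + p)))
  re-rot (a ∷ w) = begin
    + rot a * e (L.map rot (a ∷ w))  ≡⟨ cong (+ rot a *_) (e-rot (a ∷ w)) ⟩
    + rot a * E                      ≡⟨ arr₁ (+ rot a) (+ p) (+ (suc a / p)) E ⟩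
    (+ rot a + + p * + (suc a / p)) * E + (- + p) * (+ (suc a / p) * E)
      ≡⟨ cong (λ z → z * E + (- + p) * (+ (suc a / p) * E)) (sym (pos-divMod (suc a))) ⟩
    (1ℤ + + a) * E + (- + p) * (+ (suc a / p) * E)
      ≡⟨ cong (_+ (- + p) * (+ (suc a / p) * E)) (arr₂ (+ a) E) ⟩
    + a * E + E + (- + p) * (+ (suc a / p) * E) ∎
    where
    open ≡-Reasoning
    E = e (a ∷ w)
    arr₁ : ∀ r p q E → r * E ≡ (r + p * q) * E + (- p) * (q * E)
    arr₁ = solve-∀
    arr₂ : ∀ a E → (1ℤ + a) * E ≡ a * E + E
    arr₂ = solve-∀

  -- Neighbouring factors of `e` share a letter, so an adjacent repeat lies inside a single `β`,
  -- unless it is at the end of a word of even length, where `e` is 0 anyway.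
  e-normalised : Normalised e
  e-normalised (a ∷ [])        (there ())
  e-normalised (a ∷ b ∷ [])    _                       = refl
  e-normalised (a ∷ .a ∷ c ∷ w) here                   = cong (λ z → + z * e (c ∷ w)) (β-diagˡ a c)
  e-normalised (a ∷ b ∷ .b ∷ w) (there here)           = cong (λ z → + z * e (b ∷ w)) (β-diagʳ a b)
  e-normalised (a ∷ b ∷ c ∷ w) (there (there r))       =
    trans (cong (+ β a b c *_) (e-normalised (c ∷ w) r)) (ℤP.*-zeroʳ (+ β a b c))

  o-normalised : Normalised o
  o-normalised (a ∷ .a ∷ w) here      = cong (λ z → + z * e (a ∷ w)) (u-diag a)
  o-normalised (a ∷ [])     _         = refl
  o-normalised (a ∷ b ∷ w)  (there r) =
    trans (cong (+ u a b *_) (e-normalised (b ∷ w) r)) (ℤP.*-zeroʳ (+ u a b))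

  -- Words of n + 1 letters have degree n: `e` lives in even degrees and `o` in odd ones.
  κ : Bool → Cochain
  κ false = e
  κ true  = o

  κ-normalised : ∀ b → Normalised (κ b)
  κ-normalised false = e-normalised
  κ-normalised true  = o-normalised

  -- The degree modulo p and the Tucker lemma.

  infix 4 _≡ₚ_
  _≡ₚ_ : ℤ → ℤ → Set
  x ≡ₚ y = ∃ λ k → x ≡ y + + p * k

  P-o-fold : ∀ {n} {s : Signed p n → ℕ} → Equivariant s → ∀ d j X → P s d o (fold X ρ* j) ≡ P s d o X
  P-o-fold eqv d zero    X = refl
  P-o-fold {s = s} eqv d (suc j) X = trans (P-ρ* eqv d o (fold X ρ* j))
    (trans (ext (P-linear s d (fold X ρ* j)) o-rot) (P-o-fold eqv d j X))

  -- δ o = p e and the norm of an invariant cochain is p times it; δ re = o mod p, and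
  -- ρ re - re = e mod p.
  degree-step : ∀ b {n} {S : (Signed p (suc n) → ℤ) → ℤ} {T : (Signed p n → ℤ) → ℤ} →
    Linear S → Linear T → (∀ f → S (D f) ≡ T (τ b (f ∘ (nothing ∷_)))) →
    (s : Signed p (suc n) → ℕ) → Equivariant s → ∀ d →
    S (P s (suc d) (κ (not b))) ≡ₚ T (P (s ∘ (nothing ∷_)) d (κ b))
  degree-step true {S = S} {T} LS LT st s eqv d = 0ℤ , trans (ℤP.*-cancelˡ-≡ (+ p) _ _ (begin
    + p * S (P s (suc d) e)              ≡⟨ sym (scale LS (+ p) (P s (suc d) e)) ⟩
    S (λ X → + p * P s (suc d) e X)      ≡⟨ ext LS (λ X → sym (scale (P-linear s (suc d) X) (+ p) e)) ⟩
    S (P s (suc d) (λ w → + p * e w))    ≡⟨ ext LS (λ X → ext (P-linear s (suc d) X) (λ w → sym (δo≡pe w))) ⟩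
    S (P s (suc d) (δ o))                ≡⟨ ext LS (P-δ s d o) ⟩
    S (D (P s d o))                      ≡⟨ st (P s d o) ⟩
    T (τ true (P s d o ∘ (nothing ∷_)))  ≡⟨ ext LT (λ X → Σ<-cong p (λ j →
        trans (P-nothing s d o (fold X ρ* j)) (P-o-fold (λ F → eqv (there F)) d j X))) ⟩
    T (λ X → Σ< p (λ _ → P s₀ d o X))    ≡⟨ ext LT (λ X → Σ<-const p (P s₀ d o X)) ⟩
    T (λ X → + p * P s₀ d o X)           ≡⟨ scale LT (+ p) (P s₀ d o) ⟩
    + p * T (P s₀ d o)                   ∎))
    (sym (trans (cong (λ z → T (P s₀ d o) + z) (ℤP.*-zeroʳ (+ p))) (ℤP.+-identityʳ _)))
    where
    open ≡-Reasoning
    s₀ = s ∘ (nothing ∷_)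
  -- The witness collects the multiples of p that come from `wrap` and `carry`.
  degree-step false {S = S} {T} LS LT st s eqv d = - (W + C) , (begin
    S (P s (suc d) o)                      ≡⟨ arr₁ (S (P s (suc d) o)) (+ p) C ⟩
    (S (P s (suc d) o) + + p * C) - + p * C
      ≡⟨ cong (_- + p * C) (sym (lin LS (+ p) (P s (suc d) o) (P s (suc d) carry))) ⟩
    S (λ X → P s (suc d) o X + + p * P s (suc d) carry X) - + p * C
      ≡⟨ cong (_- + p * C) (ext LS (λ X → sym (lin (P-linear s (suc d) X) (+ p) o carry))) ⟩
    S (P s (suc d) (λ w → o w + + p * carry w)) - + p * C
      ≡⟨ cong (_- + p * C) (ext LS (λ X → ext (P-linear s (suc d) X) (λ w → sym (δre≡o+pcarry w)))) ⟩
    S (P s (suc d) (δ re)) - + p * C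
      ≡⟨ cong (_- + p * C) (trans (ext LS (P-δ s d re)) (st (P s d re))) ⟩
    T (λ X → P s d re (nothing ∷ ρ* X) - P s d re (nothing ∷ X)) - + p * C
      ≡⟨ cong (_- + p * C) (ext LT τP) ⟩
    T (λ X → P s₀ d e X + (- + p) * P s₀ d wrap X) - + p * C
      ≡⟨ cong (_- + p * C) (lin LT (- + p) (P s₀ d e) (P s₀ d wrap)) ⟩
    (T (P s₀ d e) + (- + p) * W) - + p * C
      ≡⟨ arr₂ (T (P s₀ d e)) (+ p) W C ⟩
    T (P s₀ d e) + + p * (- (W + C)) ∎)
    where
    open ≡-Reasoning
    s₀ = s ∘ (nothing ∷_)
    C  = S (P s (suc d) carry)
    W  = T (P s₀ d wrap)
    arr₁ : ∀ x p c → x ≡ (x + p * c) - p * c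
    arr₁ = solve-∀
    arr₂ : ∀ x p w c → (x + (- p) * w) - p * c ≡ x + p * (- (w + c))
    arr₂ = solve-∀
    arr₃ : ∀ x y z → (x + y + z) - x ≡ y + z
    arr₃ = solve-∀
    τP : ∀ X → P s d re (nothing ∷ ρ* X) - P s d re (nothing ∷ X) ≡ P s₀ d e X + (- + p) * P s₀ d wrap X
    τP X = begin
      P s d re (nothing ∷ ρ* X) - P s d re (nothing ∷ X)
        ≡⟨ cong₂ _-_ (P-nothing s d re (ρ* X)) (P-nothing s d re X) ⟩
      P s₀ d re (ρ* X) - P s₀ d re X
        ≡⟨ cong (_- P s₀ d re X) (trans (P-ρ* (λ F → eqv (there F)) d re X) (ext (P-linear s₀ d X) re-rot)) ⟩
      P s₀ d (λ w → re w + e w + (- + p) * wrap w) X - P s₀ d re X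
        ≡⟨ cong (_- P s₀ d re X) (trans (lin (P-linear s₀ d X) (- + p) _ wrap)
             (cong (_+ (- + p) * P s₀ d wrap X) (add (P-linear s₀ d X) re e))) ⟩
      P s₀ d re X + P s₀ d e X + (- + p) * P s₀ d wrap X - P s₀ d re X
        ≡⟨ arr₃ (P s₀ d re X) (P s₀ d e X) _ ⟩
      P s₀ d e X + (- + p) * P s₀ d wrap X ∎

  -- `degree-step` lowers the dimension to a single vertex, where `e` of a one-letter word is 1.
  degree≡1 : ∀ n (s : Signed p (suc n) → ℕ) → Equivariant s →
    H n (P s (suc n) (κ (parity n))) ≡ₚ 1ℤ
  degree≡1 zero    s eqv = 0ℤ , sym (cong (λ z → 1ℤ + z) (ℤP.*-zeroʳ (+ p)))
  degree≡1 (suc n) s eqv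
    with degree-step (parity n) (H-linear (suc n)) (H-linear n) (stokes n) s eqv (suc n)
       | degree≡1 n (s ∘ (nothing ∷_)) (λ F → eqv (there F))
  ... | k , eq | k′ , eq′ = k′ + k , trans eq (trans (cong (_+ + p * k) eq′) (arr (+ p) k′ k))
    where arr : ∀ p x y → 1ℤ + p * x + p * y ≡ 1ℤ + p * (x + y)
          arr = solve-∀

  -- The alternating chain is replaced by a rank `ℓ` that must drop whenever the label changes. Were
  -- M below n, the pullback would vanish everywhere by `P-vanish`, making its degree 0 rather than
  -- 1 modulo p.
  tucker : 1 ℕ.≤ m → ∀ n (s ℓ : Signed p n → ℕ) → Equivariant s →
    (∀ {a Y X} → Face a Y X → 1 ℕ.≤ ℓ X) →
    (∀ {a Y X} → Face a Y X → ℓ Y ℕ.< ℓ X ⊎ s Y ≡ s X) →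
    ∀ M → (∀ X → ℓ X ℕ.≤ M) → n ℕ.≤ M
  tucker 1≤m zero    s ℓ eqv pos drop M bound = z≤n
  tucker 1≤m (suc n) s ℓ eqv pos drop M bound with ℕP.≤-<-connex (suc n) M
  ... | inj₁ n<M = n<M
  ... | inj₂ M<n with degree≡1 n s eqv
  ...   | k , eq = ⊥-elim (p∤1 k (trans (sym (trans (ext (H-linear n) (λ X → P-vanish s ℓ pos drop (suc n)
                   (κ (parity n)) (κ-normalised (parity n)) X (ℕP.≤-<-trans (bound X) M<n))) (zer (H-linear n)))) eq))
    where
    p∤1 : ∀ k → 0ℤ ≡ 1ℤ + + p * k → ⊥
    p∤1 k eq = ℕP.<-irrefl (sym (ℕP.m*n≡1⇒m≡1 p ℤ.∣ k ∣ (trans (sym (ℤP.abs-* (+ p) k))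
      (cong ℤ.∣_∣ (neg (+ p * k) eq))))) (s≤s 1≤m)
      where
      neg : ∀ x → 0ℤ ≡ 1ℤ + x → x ≡ - 1ℤ
      neg x h = trans (arr x) (cong (λ z → z - 1ℤ) (sym h))
        where arr : ∀ x → x ≡ (1ℤ + x) - 1ℤ
              arr = solve-∀

-- Equivariant centres of subsets of ℤ/p.

module KneserBound (m : ℕ) (pr : Prime (suc m)) where
  open import Data.Nat using (_+_; _*_; _≤_; _<_; _≤?_; _<?_; _≟_; s≤s⁻¹; nonTrivial⇒n>1)
  open ℕSolver using (solve-∀)
  open Subdivision
  open Residues m
  open Tucker m

  Proper : ℕ → Set
  Proper c = 1 ≤ c × c < p

  proper? : ∀ c → Dec (Proper c)
  proper? c = (1 ≤? c) ×-dec (c <? p)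

  negative-inverse : ∀ c → Proper c → ∃ λ d → ∃ λ q → suc (d * c) ≡ q * p
  negative-inverse c@(suc _) (_ , c<p) with coprime-Bézout (prime⇒coprime pr c<p)
  ... | Bézout.+- x y eq = y , x , eq
  -- Here y inverts c, and m y is congruent to - y.
  ... | Bézout.-+ x y eq = m * y , suc (m * x) , (begin
    suc (m * y * c)         ≡⟨ cong suc (ℕP.*-assoc m y c) ⟩
    suc (m * (y * c))       ≡⟨ cong (λ z → suc (m * z)) (sym eq) ⟩
    suc (m * suc (x * p))   ≡⟨ arr m x ⟩
    suc (m * x) * p         ∎)
    where
    open ≡-Reasoning
    arr : ∀ m x → suc (m * suc (x * suc m)) ≡ suc (m * x) * suc m
    arr = solve-∀

  ninv : ℕ → ℕ
  ninv c with proper? c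
  ... | yes pc = proj₁ (negative-inverse c pc)
  -- A default outside the sizes for which centres are taken.
  ... | no  _  = 0

  ninv-spec : ∀ c → Proper c → ∃ λ q → suc (ninv c * c) ≡ q * p
  ninv-spec c pc with proper? c
  ... | yes pc′ = proj₂ (negative-inverse c pc′)
  ... | no ¬pc  = contradiction pc ¬pc

  -- The sum of the elements as numbers: within the tail each is counted 1 too low, which the size
  -- of the tail restores.
  positions : ∀ {n} → Subset n → ℕ
  positions []       = 0
  positions (x ∷ xs) = positions xs + ∣ xs ∣

  size-∷ : ∀ {n} x (xs : Subset n) → ∣ x ∷ xs ∣ ≡ ∣ x ∷ [] ∣ + ∣ xs ∣
  size-∷ true  xs = refl
  size-∷ false xs = refl

  size-∷ʳ : ∀ {n} (xs : Subset n) x → ∣ xs ∷ʳ x ∣ ≡ ∣ x ∷ [] ∣ + ∣ xs ∣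
  size-∷ʳ []           x = sym (ℕP.+-identityʳ _)
  size-∷ʳ (true  ∷ xs) x = trans (cong suc (size-∷ʳ xs x)) (sym (ℕP.+-suc _ _))
  size-∷ʳ (false ∷ xs) x = size-∷ʳ xs x

  positions-∷ʳ : ∀ {n} (xs : Subset n) x → positions (xs ∷ʳ x) ≡ positions xs + n * ∣ x ∷ [] ∣
  positions-∷ʳ []       x = refl
  positions-∷ʳ {suc n} (y ∷ xs) x = trans (cong₂ _+_ (positions-∷ʳ xs x) (size-∷ʳ xs x))
    (arr (positions xs) n ∣ x ∷ [] ∣ ∣ xs ∣)
    where arr : ∀ a n b c → a + n * b + (b + c) ≡ a + c + suc n * b
          arr = solve-∀

  rotate : Subset p → Subset p
  rotate (x ∷ xs) = xs ∷ʳ x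

  size-rotate : ∀ S → ∣ rotate S ∣ ≡ ∣ S ∣
  size-rotate (x ∷ xs) = trans (size-∷ʳ xs x) (sym (size-∷ x xs))

  -- Every element drops by 1, except that 0 turns into p - 1; the correction by p occurs exactly
  -- when 0 belongs to `S`.
  positions-rotate : ∀ S → ∃ λ b → positions (rotate S) + ∣ S ∣ ≡ positions S + b * p
  positions-rotate (x ∷ xs) = ∣ x ∷ [] ∣ ,
    trans (cong₂ _+_ (positions-∷ʳ xs x) (size-∷ x xs)) (arr (positions xs) m ∣ x ∷ [] ∣ ∣ xs ∣)
    where arr : ∀ a m b c → a + m * b + (b + c) ≡ a + c + b * suc m
          arr = solve-∀

  -- Minus the mean of the elements; rotate lowers every element by 1.
  centre : Subset p → ℕ
  centre S = (ninv ∣ S ∣ * positions S) % p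

  -- The product of `ninv ∣ S ∣` and `∣ S ∣` is - 1 modulo p, so lowering the sum of the elements by
  -- `∣ S ∣` raises the centre by 1.
  centre-rotate : ∀ S → Proper ∣ S ∣ → centre (rotate S) ≡ rot (centre S)
  centre-rotate S prS with ninv-spec ∣ S ∣ prS | positions-rotate S
  ... | q , dc | b , pos = begin
    (ninv ∣ rotate S ∣ * W′) % p        ≡⟨ cong (λ c → (ninv c * W′) % p) (size-rotate S) ⟩
    (d * W′) % p                        ≡⟨ sym (+p≋ (d * W′) q) ⟩
    (d * W′ + q * p) % p            ≡⟨ cong (λ z → (d * W′ + z) % p) (sym dc) ⟩
    (d * W′ + suc (d * ∣ S ∣)) % p  ≡⟨ cong (_% p) (arr₁ d W′ ∣ S ∣) ⟩
    suc (d * (W′ + ∣ S ∣)) % p        ≡⟨ cong (λ z → suc (d * z) % p) pos ⟩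
    suc (d * (W + b * p)) % p       ≡⟨ cong (_% p) (arr₂ d W b p) ⟩
    (suc (d * W) + d * b * p) % p ≡⟨ +p≋ (suc (d * W)) (d * b) ⟩
    suc (d * W) % p                     ≡⟨ sym (+-≋ 1 1 ((d * W) % p) (d * W) refl (%-≋ (d * W))) ⟩
    rot (centre S)                        ∎
    where
    open ≡-Reasoning
    d  = ninv ∣ S ∣
    W  = positions S
    W′ = positions (rotate S)
    arr₁ : ∀ d w c → d * w + suc (d * c) ≡ suc (d * (w + c))
    arr₁ = solve-∀
    arr₂ : ∀ d w b p → suc (d * (w + b * p)) ≡ suc (d * w) + d * b * p
    arr₂ = solve-∀

  firstCentre : ∀ {J} → Vec (Subset p) J → ℕ → ℕ
  firstCentre []       c = c
  firstCentre (S ∷ Ss) c with proper? ∣ S ∣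
  ... | yes _ = centre S
  ... | no  _ = firstCentre Ss c

  firstCentre-rotate : ∀ {J} (Ss : Vec (Subset p) J) c →
    firstCentre (V.map rotate Ss) (rot c) ≡ rot (firstCentre Ss c)
  firstCentre-rotate []       c = refl
  firstCentre-rotate (S ∷ Ss) c with proper? ∣ S ∣ | proper? ∣ rotate S ∣
  ... | yes pS | yes _   = centre-rotate S pS
  ... | yes pS | no ¬pS′ = contradiction (subst Proper (sym (size-rotate S)) pS) ¬pS′
  ... | no ¬pS | yes pS′ = contradiction (subst Proper (size-rotate S) pS′) ¬pS
  ... | no _   | no _    = firstCentre-rotate Ss c

  -- Needed when a deletion changes none of the sets: only the fallback label could then differ.
  firstCentre-const : ∀ {J} (Ss : Vec (Subset p) J) c c′ j → Proper ∣ V.lookup Ss j ∣ →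
    firstCentre Ss c ≡ firstCentre Ss c′
  firstCentre-const (S ∷ Ss) c c′ j pj with proper? ∣ S ∣
  ... | yes _ = refl
  firstCentre-const (S ∷ Ss) c c′ F.zero    pj | no ¬pS = contradiction pj ¬pS
  firstCentre-const (S ∷ Ss) c c′ (F.suc j) pj | no _   = firstCentre-const Ss c c′ j pj

  tabulate-∷ʳ : ∀ {A : Set} n (f : Fin (suc n) → A) →
    V.tabulate f ≡ V.tabulate (f ∘ inject₁) ∷ʳ f (fromℕ n)
  tabulate-∷ʳ zero    f = refl
  tabulate-∷ʳ (suc n) f = cong (f F.zero ∷_) (tabulate-∷ʳ n (f ∘ F.suc))

  tabulate-rotate : (f g : Fin p → Bool) → (∀ a → g (ρ a) ≡ f a) → V.tabulate g ≡ rotate (V.tabulate f)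
  tabulate-rotate f g eq = trans (tabulate-∷ʳ m g)
    (cong₂ _∷ʳ_ (VP.tabulate-cong (eq ∘ F.suc)) (eq F.zero))

  ⊆⇒<⊎≡ : ∀ {n} (S T : Subset n) → S ⊆ T → ∣ S ∣ < ∣ T ∣ ⊎ S ≡ T
  ⊆⇒<⊎≡ []          []          S⊆T = inj₂ refl
  ⊆⇒<⊎≡ (true ∷ S)  (true ∷ T)  S⊆T = Sum.map s≤s (cong (true ∷_)) (⊆⇒<⊎≡ S T (SP.drop-∷-⊆ S⊆T))
  ⊆⇒<⊎≡ (false ∷ S) (false ∷ T) S⊆T = Sum.map id (cong (false ∷_)) (⊆⇒<⊎≡ S T (SP.drop-∷-⊆ S⊆T))
  ⊆⇒<⊎≡ (false ∷ S) (true ∷ T)  S⊆T = inj₁ (s≤s (SP.p⊆q⇒∣p∣≤∣q∣ (SP.drop-∷-⊆ S⊆T)))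
  ⊆⇒<⊎≡ (true ∷ S)  (false ∷ T) S⊆T with S⊆T V.here
  ... | ()

  -- Total sizes of families of subsets.

  total : ∀ {n J} → (Fin J → Subset n) → ℕ
  total S = V.sum (V.tabulate (λ j → ∣ S j ∣))

  total-mono : ∀ {n} J (S T : Fin J → Subset n) → (∀ j → S j ⊆ T j) →
    total S < total T ⊎ (∀ j → S j ≡ T j)
  total-mono zero    S T S⊆T = inj₂ λ ()
  total-mono (suc J) S T S⊆T
    with ⊆⇒<⊎≡ (S F.zero) (T F.zero) (S⊆T F.zero) | total-mono J (S ∘ F.suc) (T ∘ F.suc) (S⊆T ∘ F.suc)
  ... | inj₁ lt | inj₁ lt′ = inj₁ (ℕP.+-mono-< lt lt′)
  ... | inj₁ lt | inj₂ eq  = inj₁ (ℕP.+-mono-<-≤ lt (ℕP.≤-reflexive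
          (cong V.sum (VP.tabulate-cong (λ j → cong ∣_∣ (eq j))))))
  ... | inj₂ eq | inj₁ lt′ = inj₁ (ℕP.+-mono-≤-< (ℕP.≤-reflexive (cong ∣_∣ eq)) lt′)
  ... | inj₂ eq | inj₂ eq′ = inj₂ λ { F.zero → eq ; (F.suc j) → eq′ j }

  total-bound : ∀ {n} J (S : Fin J → Subset n) → total S ≤ J * n
  total-bound zero    S = z≤n
  total-bound (suc J) S = ℕP.+-mono-≤ (SP.∣p∣≤n (S F.zero)) (total-bound J (S ∘ F.suc))

  size≤total : ∀ {n} J (S : Fin J → Subset n) j → ∣ S j ∣ ≤ total S
  size≤total (suc J) S F.zero    = ℕP.m≤m+n _ _
  size≤total (suc J) S (F.suc j) = ℕP.≤-trans (size≤total J (S ∘ F.suc) j) (ℕP.m≤n+m _ _)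

  ∈⇒1≤size : ∀ {n} {x : Fin n} {S : Subset n} → x ∈ S → 1 ≤ ∣ S ∣
  ∈⇒1≤size V.here = s≤s z≤n
  ∈⇒1≤size {S = true  ∷ S} (V.there x∈S) = s≤s z≤n
  ∈⇒1≤size {S = false ∷ S} (V.there x∈S) = ∈⇒1≤size x∈S

  ∉⇒size<n : ∀ {n} (x : Fin n) (S : Subset n) → ¬ x ∈ S → ∣ S ∣ < n
  ∉⇒size<n F.zero    (true ∷ S)  x∉S = contradiction V.here x∉S
  ∉⇒size<n F.zero    (false ∷ S) x∉S = s≤s (SP.∣p∣≤n S)
  ∉⇒size<n (F.suc x) (true ∷ S)  x∉S = s≤s (∉⇒size<n x S (x∉S ∘ V.there))
  ∉⇒size<n (F.suc x) (false ∷ S) x∉S = ℕP.m<n⇒m<1+n (∉⇒size<n x S (x∉S ∘ V.there))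

  ⟦_⟧ : ∀ {n} {Q : Fin n → Set} → (∀ x → Dec (Q x)) → Subset n
  ⟦ Q? ⟧ = V.tabulate (does ∘ Q?)

  ∈⟦⟧⁺ : ∀ {n} {Q : Fin n → Set} (Q? : ∀ x → Dec (Q x)) {x} → Q x → x ∈ ⟦ Q? ⟧
  ∈⟦⟧⁺ Q? {x} q = VP.lookup⇒[]= x _ (trans (VP.lookup∘tabulate (does ∘ Q?) x) (dec-true (Q? x) q))

  ∈⟦⟧⁻ : ∀ {n} {Q : Fin n → Set} (Q? : ∀ x → Dec (Q x)) {x} → x ∈ ⟦ Q? ⟧ → Q x
  ∈⟦⟧⁻ Q? {x} x∈ with Q? x | trans (sym (VP.lookup∘tabulate (does ∘ Q?) x)) (VP.[]=⇒lookup x∈)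
  ... | yes q | _ = q

  -- Multiplication by m negates modulo p, since labels must rise when `ρ` lowers signs.
  -- Equivariance makes no claim about the value at the zero vector.
  firstSign : ∀ {n} → Signed p n → ℕ
  firstSign []            = 0
  firstSign (nothing ∷ X) = firstSign X
  firstSign (just a ∷ X)  = (m * toℕ a) % p

  firstSign-ρ* : ∀ {n} → Equivariant (firstSign {n})
  firstSign-ρ* {X = just b ∷ X}  F = begin
    (m * toℕ (ρ b)) % p                 ≡⟨ sym (+p≋ (m * toℕ (ρ b)) 1) ⟩
    (m * toℕ (ρ b) + 1 * p) % p     ≡⟨ cong (_% p) (arr m (toℕ (ρ b))) ⟩
    (1 + m * suc (toℕ (ρ b))) % p     ≡⟨ +-≋ 1 1 (m * suc (toℕ (ρ b))) (m * toℕ b) refl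
                                               (*-≋ m m (suc (toℕ (ρ b))) (toℕ b) refl (toℕ-ρ b)) ⟩
    (1 + m * toℕ b) % p               ≡⟨ sym (+-≋ 1 1 ((m * toℕ b) % p) (m * toℕ b) refl (%-≋ (m * toℕ b))) ⟩
    rot ((m * toℕ b) % p)               ∎
    where
    open ≡-Reasoning
    arr : ∀ m b → m * b + 1 * suc m ≡ 1 + m * suc b
    arr = solve-∀
  firstSign-ρ* {X = nothing ∷ X} (there F) = firstSign-ρ* F

  1≤m : 1 ≤ m
  1≤m = s≤s⁻¹ (nonTrivial⇒n>1 p {{prime⇒nonTrivial pr}})

  -- Applies `tucker` with the total size of the J sets as rank. `detect` makes the rank positive.
  -- If a deletion changes no set, `split` provides a nonempty proper one, so both vectors take
  -- their label from the same centre.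
  feature-bound : ∀ {n} J (Q : Signed p n → Fin J → Fin p → Set) →
    (∀ X j g → Dec (Q X j g)) →
    (∀ {a Y X} → Face a Y X → ∀ j g → Q Y j g → Q X j g) →
    (∀ X j g → Q X j g ⇔ Q (ρ* X) j (ρ g)) →
    (∀ {a Y X} → Face a Y X → ∃ λ j → Q X j a) →
    (∀ {a Y X} → Face a Y X → (∀ j g → Q X j g → Q Y j g) →
      ∃ λ j → (∃ λ g → Q X j g) × (∃ λ g → ¬ Q X j g)) →
    n ≤ J * p
  feature-bound {n} J Q Q? mono eqv detect split =
    tucker 1≤m n s (total ∘ S) s-eqv
      (λ {_} {_} {X} F → let (j , q) = detect F in
        ℕP.≤-trans (∈⇒1≤size (∈⟦⟧⁺ (Q? X j) q)) (size≤total J (S X) j))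
      drop (J * p) (λ X → total-bound J (S X))
    where
    S : Signed p n → Fin J → Subset p
    S X j = ⟦ Q? X j ⟧
    s : Signed p n → ℕ
    s X = firstCentre (V.tabulate (S X)) (firstSign X)
    s-eqv : Equivariant s
    s-eqv {X = X} F = trans (cong₂ firstCentre (trans (VP.tabulate-cong (λ j →
        tabulate-rotate (does ∘ Q? X j) (does ∘ Q? (ρ* X) j)
          (λ g → sym (does-⇔ (eqv X j g) (Q? X j g) (Q? (ρ* X) j (ρ g))))))
        (VP.tabulate-∘ rotate (S X))) (firstSign-ρ* F))
      (firstCentre-rotate (V.tabulate (S X)) (firstSign X))
    drop : ∀ {a Y X} → Face a Y X → total (S Y) < total (S X) ⊎ s Y ≡ s X
    drop {a} {Y} {X} F with total-mono J (S Y) (S X)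
      (λ j {g} g∈ → ∈⟦⟧⁺ (Q? X j) (mono F j g (∈⟦⟧⁻ (Q? Y j) g∈)))
    ... | inj₁ lt = inj₁ lt
    ... | inj₂ eq with split F (λ j g q → ∈⟦⟧⁻ (Q? Y j) (subst (g ∈_) (sym (eq j)) (∈⟦⟧⁺ (Q? X j) q)))
    ...   | j , (g , q) , (h , ¬q) = inj₂ (trans
              (cong (λ Ss → firstCentre Ss (firstSign Y)) (VP.tabulate-cong eq))
              (firstCentre-const (V.tabulate (S X)) (firstSign Y) (firstSign X) j
                (subst (Proper ∘ ∣_∣) (sym (VP.lookup∘tabulate (S X) j))
                  (∈⇒1≤size (∈⟦⟧⁺ (Q? X j) q) , ∉⇒size<n h (S X j) (¬q ∘ ∈⟦⟧⁻ (Q? X j))))))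

  -- Sign classes and finite searches.

  _≟ₘ_ : (x y : Maybe (Fin p)) → Dec (x ≡ y)
  _≟ₘ_ = MP.≡-dec F._≟_

  class : ∀ {n} → Fin p → Signed p n → Subset n
  class g = V.map (λ x → does (x ≟ₘ just g))

  ∈class⁻ : ∀ {n} g (X : Signed p n) {x} → x ∈ class g X → V.lookup X x ≡ just g
  ∈class⁻ g X {x} x∈ with V.lookup X x ≟ₘ just g
    | trans (sym (VP.lookup-map x (λ y → does (y ≟ₘ just g)) X)) (VP.[]=⇒lookup x∈)
  ... | yes eq | _ = eq

  class-disjoint : ∀ {n} {g h} (X : Signed p n) {x} → g ≢ h → x ∈ class g X → ¬ x ∈ class h X
  class-disjoint {g = g} {h} X g≢h x∈g x∈h =
    g≢h (MP.just-injective (trans (sym (∈class⁻ g X x∈g)) (∈class⁻ h X x∈h)))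

  class-ρ* : ∀ {n} g (X : Signed p n) → class (ρ g) (ρ* X) ≡ class g X
  class-ρ* g X = trans (sym (VP.map-∘ _ (M.map ρ) X)) (VP.map-cong (λ x →
    does-⇔ (mk⇔ (MP.map-injective ρ-injective) (cong (M.map ρ))) (M.map ρ x ≟ₘ just (ρ g)) (x ≟ₘ just g)) X)

  class-mono : ∀ {n a} {Y X : Signed p n} → Face a Y X → ∀ g → class g Y ⊆ class g X
  class-mono here      g = SP.out⊆ id
  class-mono (there F) g = SP.s⊆s (class-mono F g)

  class-face : ∀ {n a} {Y X : Signed p n} → Face a Y X → ∣ class a X ∣ ≡ suc ∣ class a Y ∣
  class-face {a = a} (here {X = X}) = cong (λ b → ∣ b ∷ class a X ∣) (dec-true (just a ≟ₘ just a) refl)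
  class-face {a = a} (there {x = x} F) with does (x ≟ₘ just a)
  ... | true  = cong suc (class-face F)
  ... | false = class-face F

  anyTuple? : ∀ {n} k {Q : Vec (Subset n) k → Set} → (∀ V → Dec (Q V)) → Dec (∃ Q)
  anyTuple? zero    Q? = map′ ([] ,_) (λ { ([] , q) → q }) (Q? [])
  anyTuple? (suc k) Q? = map′ (λ { (S , V , q) → S ∷ V , q }) (λ { (S ∷ V , q) → S , V , q })
    (SP.anySubset? (λ S → anyTuple? k (λ V → Q? (S ∷ V))))

  shrink : ∀ {n} k (S : Subset n) → k ≤ ∣ S ∣ → ∃ λ T → T ⊆ S × ∣ T ∣ ≡ k
  shrink k       []          z≤n = [] , id , refl
  shrink zero    (true ∷ S)  _         with shrink zero S z≤n
  ... | T , T⊆S , eq = false ∷ T , SP.out⊆ T⊆S , eq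
  shrink (suc k) (true ∷ S)  (s≤s k≤S) with shrink k S k≤S
  ... | T , T⊆S , eq = true ∷ T , SP.s⊆s T⊆S , cong suc eq
  shrink k       (false ∷ S) k≤S       with shrink k S k≤S
  ... | T , T⊆S , eq = false ∷ T , SP.s⊆s T⊆S , eq

  isKNVertex? : ∀ {n k m} (A : Tuple n m) → Dec (IsKNVertex n k m A)
  isKNVertex? {n} {k} A =
    FP.all? (λ i → ∣ A i ∣ ≟ k) ×-dec
    FP.all? (λ i → FP.all? λ j → ¬? (i F.≟ j) →-dec
      FP.all? λ x → (x SP.∈? A i) →-dec ¬? (x SP.∈? A j))

  -- Features of sign vectors from a proper colouring.

  module Colouring {n k t : ℕ} (1≤k : 1 ≤ k) (col : ProperColouring n k m t) where

    IsVertex? : (V : Vec (Subset n) m) → Dec (IsKNVertex n k m (V.lookup V))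
    IsVertex? V = isKNVertex? (V.lookup V)

    -- True pins down one proof of vertexhood per tuple, on which the colour might depend.
    colour : (V : Vec (Subset n) m) → True (IsVertex? V) → Fin t
    colour V w = proj₁ col (V.lookup V , toWitness w)

    -- The m sets take the signs g, g - 1, ..., g - (m - 1), which are all signs except g + 1.
    Within : Signed p n → Fin p → Vec (Subset n) m → Set
    Within X g V = ∀ i → V.lookup V i ⊆ class (fold g ρ (toℕ i)) X

    Occurs : Signed p n → Fin t → Fin p → Set
    Occurs X c g = ∃ λ V → Within X g V × Σ (True (IsVertex? V)) λ w → colour V w ≡ c

    occurs? : ∀ X c g → Dec (Occurs X c g)
    occurs? X c g = anyTuple? m λ V →
      FP.all? (λ i → V.lookup V i SP.⊆? class (fold g ρ (toℕ i)) X) ×-dec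
      Σ-dec (IsVertex? V) (λ w → colour V w F.≟ c)
      where
      Σ-dec : ∀ {A : Set} (A? : Dec A) {B : True A? → Set} → (∀ w → Dec (B w)) → Dec (Σ (True A?) B)
      Σ-dec (yes a) B? = map′ (_ ,_) proj₂ (B? _)
      Σ-dec (no ¬a) B? = no λ ()

    -- Set j of `V` has sign g - j and set l of `V′` has sign g - (l + 1). For j ≤ i ≤ l the
    -- exponents j and l + 1 are distinct and below p, so the classes are disjoint.
    precedes : ∀ {X g V V′} → Within X g V → Within X (ρ g) V′ → Precedes (V.lookup V) (V.lookup V′)
    precedes {X} {g} V⊆ V′⊆ i x ((j , j≤i , x∈V) , (l , i≤l , x∈V′)) =
      class-disjoint X distinct (V⊆ j x∈V) (V′⊆ l x∈V′)
      where
      distinct : fold g ρ (toℕ j) ≢ fold (ρ g) ρ (toℕ l)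
      distinct eq = ℕP.<⇒≢ (s≤s (ℕP.≤-trans j≤i i≤l))
        (ρ^-injective g (toℕ j) (suc (toℕ l)) (ℕP.<-trans (FP.toℕ<n j) (ℕP.n<1+n m)) (s≤s (FP.toℕ<n l))
          (trans eq (fold-comm ρ g (toℕ l))))

    not-both : ∀ {X c g} → Occurs X c g → ¬ Occurs X c (ρ g)
    not-both {X} {c} {g} (V , V⊆ , w , eq) (V′ , V′⊆ , w′ , eq′) =
      proj₂ col _ _ (inj₁ (precedes {X} {g} {V} {V′} V⊆ V′⊆)) (trans eq (sym eq′))

    large⇒occurs : ∀ X → (∀ g → k ≤ ∣ class g X ∣) → ∀ g → ∃ λ c → Occurs X c g
    large⇒occurs X large g = colour V w , V , V⊆ , w , refl
      where
      T : Fin p → Subset n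
      T h = proj₁ (shrink k (class h X) (large h))
      A : Tuple n m
      A i = T (fold g ρ (toℕ i))
      V = V.tabulate A
      V≡ : ∀ i → V.lookup V i ≡ A i
      V≡ = VP.lookup∘tabulate A
      V⊆ : Within X g V
      V⊆ i x∈ = proj₁ (proj₂ (shrink k (class (fold g ρ (toℕ i)) X) (large _))) (subst (_ ∈_) (V≡ i) x∈)
      w : True (IsVertex? V)
      w = fromWitness
        ( (λ i → trans (cong ∣_∣ (V≡ i)) (proj₂ (proj₂ (shrink k (class (fold g ρ (toℕ i)) X) (large _)))))
        , λ i j i≢j x x∈i x∈j → class-disjoint X
            (λ eq → i≢j (FP.toℕ-injective (ρ^-injective g (toℕ i) (toℕ j)
              (ℕP.<-trans (FP.toℕ<n i) (ℕP.n<1+n m)) (ℕP.<-trans (FP.toℕ<n j) (ℕP.n<1+n m)) eq)))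
            (V⊆ i x∈i) (V⊆ j x∈j))

    Feature : Signed p n → Fin k ⊎ Fin t → Fin p → Set
    Feature X (inj₁ i) g = toℕ i < ∣ class g X ∣
    Feature X (inj₂ c) g = Occurs X c g

    feature? : ∀ X j g → Dec (Feature X j g)
    feature? X (inj₁ i) g = toℕ i <? ∣ class g X ∣
    feature? X (inj₂ c) g = occurs? X c g

    feature-mono : ∀ {a Y X} → Face a Y X → ∀ j g → Feature Y j g → Feature X j g
    feature-mono F (inj₁ i) g lt = ℕP.<-≤-trans lt (SP.p⊆q⇒∣p∣≤∣q∣ (class-mono F g))
    feature-mono F (inj₂ c) g (V , V⊆ , rest) = V , (λ i x∈ → class-mono F _ (V⊆ i x∈)) , rest

    class-fold : ∀ (X : Signed p n) g i → class (fold (ρ g) ρ i) (ρ* X) ≡ class (fold g ρ i) X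
    class-fold X g i = trans (cong (λ h → class h (ρ* X)) (fold-comm ρ g i)) (class-ρ* (fold g ρ i) X)

    feature-ρ* : ∀ X j g → Feature X j g ⇔ Feature (ρ* X) j (ρ g)
    feature-ρ* X (inj₁ i) g = mk⇔
      (subst (λ S → toℕ i < ∣ S ∣) (sym (class-ρ* g X))) (subst (λ S → toℕ i < ∣ S ∣) (class-ρ* g X))
    feature-ρ* X (inj₂ c) g = mk⇔
      (λ { (V , V⊆ , rest) → V , (λ i x∈ → subst (_ ∈_) (sym (class-fold X g (toℕ i))) (V⊆ i x∈)) , rest })
      (λ { (V , V⊆ , rest) → V , (λ i x∈ → subst (_ ∈_) (class-fold X g (toℕ i)) (V⊆ i x∈)) , rest })

    feature-detect : ∀ {a Y X} → Face a Y X → ∃ λ j → Feature X j a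
    -- Threshold 0 suffices, as the class of the deleted sign is nonempty in `X`.
    feature-detect F = inj₁ (F.fromℕ< 1≤k) ,
      subst₂ _<_ (sym (FP.toℕ-fromℕ< 1≤k)) (sym (class-face F)) (s≤s z≤n)

    feature-split : ∀ {a Y X} → Face a Y X → (∀ j g → Feature X j g → Feature Y j g) →
      ∃ λ j → (∃ λ g → Feature X j g) × (∃ λ g → ¬ Feature X j g)
    feature-split {a} {Y} {X} F same with ∣ class a Y ∣ <? k
    -- The threshold `∣ class a Y ∣` holds at `a` for `X` but not for `Y`.
    ... | yes small = contradiction
            (same (inj₁ (F.fromℕ< small)) a
              (subst₂ _<_ (sym (FP.toℕ-fromℕ< small)) (sym (class-face F)) (ℕP.n<1+n _)))
            (ℕP.<-irrefl (FP.toℕ-fromℕ< small))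
    ... | no ¬small with FP.any? (λ g → ∣ class g X ∣ <? k)
    -- In `X` the class of `a` has more than k elements and that of `g` fewer, so the threshold
    -- `∣ class g X ∣` admits `a` and excludes `g`.
    ...   | yes (g , g<k) = inj₁ (F.fromℕ< g<k) ,
              (a , subst₂ _<_ (sym (FP.toℕ-fromℕ< g<k)) (sym (class-face F))
                     (ℕP.<-≤-trans g<k (ℕP.m≤n⇒m≤1+n (ℕP.≮⇒≥ ¬small)))) ,
              (g , ℕP.<-irrefl (FP.toℕ-fromℕ< g<k))
    -- All classes have at least k elements, so some colour occurs at 0, and by `not-both` it does
    -- not occur at `ρ` of 0.
    ...   | no ¬g<k with large⇒occurs X (λ g → ℕP.≮⇒≥ (λ lt → ¬g<k (g , lt))) F.zero
    ...     | c , occ = inj₂ c , (F.zero , occ) , (ρ F.zero , not-both occ)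

    bound : n ≤ (k + t) * p
    bound = feature-bound (k + t) (λ X → Feature X ∘ F.splitAt k) (λ X → feature? X ∘ F.splitAt k)
      (λ F → feature-mono F ∘ F.splitAt k) (λ X → feature-ρ* X ∘ F.splitAt k)
      (λ F → let (j , q) = feature-detect F in F.join k t j , at j (λ j → Feature _ j _) q)
      (λ {_} {Y} {X} F same →
        let (j , q) = feature-split F (λ j g q →
              subst (λ j → Feature Y j g) (FP.splitAt-join k t j)
                (same (F.join k t j) g (at j (λ j → Feature X j g) q)))
        in F.join k t j , at j (λ j → (∃ λ g → Feature X j g) × (∃ λ g → ¬ Feature X j g)) q)
      where
      at : ∀ j (Q : Fin k ⊎ Fin t → Set) → Q j → Q (F.splitAt k (F.join k t j))
      at j Q = subst Q (sym (FP.splitAt-join k t j))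

open import Data.Nat using (_+_; _*_; _≤_)

theorem4p2 : (n k m : ℕ) → 2 ≤ n → 2 ≤ m → 2 ≤ k → (suc m) * k ≤ n → Prime (suc m) →
    (t : ℕ) → ProperColouring n k m t →
    n ≤ t * (suc m * (suc m * m)) + k * suc m
theorem4p2 n k m@(suc _) _ _ 2≤k _ pr t col = begin
  n                                      ≤⟨ KneserBound.Colouring.bound m pr (ℕP.<⇒≤ 2≤k) col ⟩
  (k + t) * suc m                        ≡⟨ ℕP.*-distribʳ-+ (suc m) k t ⟩
  k * suc m + t * suc m                  ≡⟨ ℕP.+-comm (k * suc m) (t * suc m) ⟩
  -- The stated bound has the extra factor p (p - 1) on t; matching m as a successor shows this
  -- factor to be nonzero.
  t * suc m + k * suc m                  ≤⟨ ℕP.+-monoˡ-≤ (k * suc m)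
                                              (ℕP.*-monoʳ-≤ t (ℕP.m≤m*n (suc m) (suc m * m))) ⟩
  t * (suc m * (suc m * m)) + k * suc m  ∎
  where open ℕP.≤-Reasoning
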